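{- For every binary matrix $P$ such that $Q_1\preccurlyeq P$, where $Q_1\in\{0,1\}^{3\times 3}$ has $\mathrm{supp}(Q_1)=\{(1,2),(2,1),(3,3)\}$, the class $\mathrm{Av}(P)$ is row-unbounded.
   Context: All matrices are binary; rows are numbered top to bottom, columns left to right; $(i,j)$ is the entry in row $i$, column $j$, a 1-entry if it equals 1; $\mathrm{supp}$ is the set of 1-entries. For integers, $(a,b]=\{a+1,\dots,b\}$. A pattern $P\in\{0,1\}^{k\times\ell}$ is an interval minor of $M\in\{0,1\}^{m\times n}$, written $P\preccurlyeq M$, if there are integers $0=r_0<\dots<r_k=m$ and $0=c_0<\dots<c_\ell=n$ such that for each 1-entry $(i,j)$ of $P$ the submatrix of $M$ on rows $(r_{i-1},r_i]$ and columns $(c_{j-1},c_j]$ contains a 1-entry; otherwise $M$ avoids $P$. $\mathrm{Av}(P)$ is the set of binary matrices avoiding $P$. A matrix $M\in\mathcal C$ is critical for $\mathcal C$ if changing any single 0-entry of $M$ into a 1-entry gives a matrix outside $\mathcal C$. A horizontal 0-run is a maximal set of consecutive 0-entries within a single row; the complexity of a row is the number of horizontal 0-runs in it. The row-complexity of $\mathcal C$ is the supremum over matrices critical for $\mathcal C$ of the maximum complexity of a row; $\mathcal C$ is row-unbounded if this supremum is infinite. -}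

module Defs where

open import Data.Bool using (Bool; true; false)
import Data.Bool.Properties as Bool
open import Data.Fin using (Fin; zero; suc; toℕ; fromℕ; inject₁)
import Data.Fin as Fin
import Data.Fin.Properties as Fin
open import Data.List using (length; filter; map; allFin; cartesianProduct)
open import Data.List.Extrema.Nat using (max)
open import Data.Nat using (ℕ; suc; _≤_; _<_)
open import Data.Product using (Σ-syntax; ∃-syntax; _×_; _,_)
open import Data.Vec.Functional using (Vector; []; _∷_; updateAt)
open import Function using (const)
open import Relation.Binary.PropositionalEquality using (_≡_)
open import Relation.Nullary using (Dec; ¬_)
open import Relation.Nullary.Decidable using (_×-dec_; _→-dec_)

-- Entries, rows and columns are indexed from 0.  Matrices with no rows or no
-- columns are not excluded; they never have a row of positive complexity.
Matrix : ℕ → ℕ → Set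
Matrix m n = Vector (Vector Bool n) m

-- Integers 0 = r₀ < r₁ < … < r_k = m.
record Cuts (k m : ℕ) : Set where
  field
    cut        : Fin (suc k) → ℕ
    first      : cut zero ≡ 0
    last       : cut (fromℕ k) ≡ m
    increasing : ∀ (i : Fin k) → cut (inject₁ i) < cut (suc i)

-- With 0-based indices the 1-based interval (rᵢ₋₁ , rᵢ] becomes the half-open
-- interval [cut (inject₁ i) , cut (suc i)).
_∈[_]_ : ∀ {k m} → Fin m → Cuts k m → Fin k → Set
x ∈[ r ] i = cut (inject₁ i) ≤ toℕ x × toℕ x < cut (suc i)
  where open Cuts r

infix 4 _≼_

_≼_ : ∀ {k ℓ m n} → Matrix k ℓ → Matrix m n → Set
_≼_ {k} {ℓ} {m} {n} P M =
  Σ[ r ∈ Cuts k m ] Σ[ c ∈ Cuts ℓ n ] (∀ i j → P i j ≡ true →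
    ∃[ x ] ∃[ y ] (x ∈[ r ] i × y ∈[ c ] j × M x y ≡ true))

MatrixClass : Set₁
MatrixClass = ∀ (m n : ℕ) → Matrix m n → Set

Av : ∀ {k ℓ} → Matrix k ℓ → MatrixClass
Av P m n M = ¬ (P ≼ M)

setOne : ∀ {m n} → Matrix m n → Fin m → Fin n → Matrix m n
setOne M i j = updateAt M i (λ row → updateAt row j (const true))

Critical : MatrixClass → ∀ {m n} → Matrix m n → Set
Critical 𝒞 {m} {n} M =
  𝒞 m n M × (∀ i j → M i j ≡ false → ¬ 𝒞 m n (setOne M i j))

AllZero : ∀ {n} → Vector Bool n → Fin n → Fin n → Set
AllZero v a b = ∀ j → a Fin.≤ j → j Fin.≤ b → v j ≡ false

-- A nonempty set of consecutive positions {a, …, b} is represented by its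
-- endpoints; maximality is with respect to inclusion.
IsZeroRun : ∀ {n} → Vector Bool n → Fin n × Fin n → Set
IsZeroRun v (a , b) =
  a Fin.≤ b × AllZero v a b ×
  (∀ a′ b′ → a′ Fin.≤ a → b Fin.≤ b′ → AllZero v a′ b′ → a′ ≡ a × b′ ≡ b)

allZero? : ∀ {n} (v : Vector Bool n) a b → Dec (AllZero v a b)
allZero? v a b = Fin.all? λ j →
  (a Fin.≤? j) →-dec ((j Fin.≤? b) →-dec (v j Bool.≟ false))

isZeroRun? : ∀ {n} (v : Vector Bool n) ab → Dec (IsZeroRun v ab)
isZeroRun? v (a , b) =
  (a Fin.≤? b) ×-dec (allZero? v a b ×-dec
  (Fin.all? λ a′ → Fin.all? λ b′ →
    (a′ Fin.≤? a) →-dec ((b Fin.≤? b′) →-dec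
    (allZero? v a′ b′ →-dec ((a′ Fin.≟ a) ×-dec (b′ Fin.≟ b))))))

complexity : ∀ {n} → Vector Bool n → ℕ
complexity {n} v =
  length (filter (isZeroRun? v) (cartesianProduct (allFin n) (allFin n)))

maxRowComplexity : ∀ {m n} → Matrix m n → ℕ
maxRowComplexity {m} M = max 0 (map (λ i → complexity (M i)) (allFin m))

-- The supremum of maxRowComplexity over the critical matrices is infinite:
-- every natural number is exceeded.
RowUnbounded : MatrixClass → Set
RowUnbounded 𝒞 = ∀ (N : ℕ) →
  ∃[ m ] ∃[ n ] ∃[ M ] (Critical 𝒞 {m} {n} M × N < maxRowComplexity M)

Q₁ : Matrix 3 3
Q₁ = (false ∷ true  ∷ false ∷ [])
   ∷ (true  ∷ false ∷ false ∷ [])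
   ∷ (false ∷ false ∷ true  ∷ [])
   ∷ []

{-# OPTIONS --safe #-}
module Submission where

-- Let (r₁ , c₂), (r₂ , c₁), (r₃ , c₃) be the 1-entries of P representing Q₁,
-- with r₁ the lowest 1-entry of column c₂ above row r₂.  Consider a matrix M with
-- a band of r₂ - r₁ rows, full of ones except in columns z₀ < … < z_{B-1}, and
-- below it B all-ones blocks of r₃ - r₂ + 1 rows and c₃ - c₁ + 1 columns, placed
-- from bottom left to top right, with column z_t having offset c₂ - c₁ in block t;
-- all-ones margins represent the remaining rows and columns of P.  In a copy of P
-- the entries of rows r₂ and r₃ lie in one block t, since the later blocks are
-- higher.  That block has exactly the right size, so the entry of row r₁ lies in
-- column z_t and above the block, where M has no 1-entry.  A single 1-entry at
-- the top of column z_t creates a copy of P, because P is zero in column c₂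
-- between rows r₁ and r₂.  Hence every critical matrix above M keeps the B zeros
-- of the top row of the band and the ones separating them.

open import Data.Bool using (Bool; true; false)
import Data.Bool.Properties as Bool
open import Data.Empty using (⊥; ⊥-elim)
open import Data.Fin using (Fin; zero; suc; toℕ; fromℕ; fromℕ<; inject₁)
import Data.Fin as Fin
import Data.Fin.Properties as Fin
open import Data.List using ([]; _∷_; allFin; cartesianProduct)
open import Data.List.Extrema.Nat using (v≤max⁺)
open import Data.List.Membership.Propositional using (_∈_; lose)
open import Data.List.Membership.Propositional.Properties
  using (∈-filter⁺; ∈-cartesianProduct⁺; ∈-allFin; ∈-map⁺)
import Data.List.Membership.Setoid.Properties as Membershipₛ
open import Data.List.Relation.Unary.All using (All; []; _∷_) renaming (lookup to All-lookup)
open import Data.List.Relation.Unary.Any using (index)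
open import Data.Nat
open import Data.Nat.Properties
open import Data.Nat.Tactic.RingSolver using (solve-∀)
open import Data.Product using (∃; ∃-syntax; _×_; _,_; proj₁; proj₂)
open import Data.Sum using (_⊎_; inj₁; inj₂; [_,_]′)
open import Data.Vec using (Vec; []; _∷_; lookup; tabulate)
open import Data.Vec.Functional.Properties using (updateAt-updates; updateAt-minimal)
open import Data.Vec.Properties using (lookup∘tabulate)
open import Function using (_∘_; id)
open import Relation.Binary.Definitions using (tri<; tri≈; tri>)
open import Relation.Binary.PropositionalEquality
  using (_≡_; _≢_; refl; sym; trans; cong; cong₂; subst; subst₂; setoid)
open import Relation.Nullary using (Dec; yes; no; ¬_; does)
open import Relation.Nullary.Decidable
  using (map′; ¬?; _×-dec_; _→-dec_; _⊎-dec_; dec-true)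
open import Relation.Unary using (Decidable)
open import Defs

-- Zero runs of a row and a lower bound for its complexity.

least : ∀ {n} {P : Fin n → Set} → Decidable P → ∃ P →
        ∃[ a ] (P a × ∀ c → P c → a Fin.≤ c)
least {suc n} P? (x , px) with P? zero
... | yes p0 = zero , p0 , λ _ _ → z≤n
least P? (zero , px) | no ¬p0 = ⊥-elim (¬p0 px)
least {suc n} {P} P? (suc x , px) | no ¬p0
  with a , pa , min ← least (P? ∘ suc) (x , px) = suc a , pa , minimal
  where
  minimal : ∀ c → P c → suc a Fin.≤ c
  minimal zero    pc = ⊥-elim (¬p0 pc)
  minimal (suc c) pc = s≤s (min c pc)

greatest : ∀ {n} {P : Fin n → Set} → Decidable P → ∃ P →
           ∃[ b ] (P b × ∀ c → P c → c Fin.≤ b)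
greatest {suc n} {P} P? (x , px) with Fin.any? (P? ∘ suc)
... | yes ∃p with b , pb , max ← greatest (P? ∘ suc) ∃p = suc b , pb , maximal
  where
  maximal : ∀ c → P c → c Fin.≤ suc b
  maximal zero    pc = z≤n
  maximal (suc c) pc = s≤s (max c pc)
greatest P? (suc x , px) | no ¬p = ⊥-elim (¬p (x , px))
greatest {suc n} {P} P? (zero , px) | no ¬p = zero , px , maximal
  where
  maximal : ∀ c → P c → c Fin.≤ zero {n}
  maximal zero    pc = z≤n
  maximal (suc c) pc = ⊥-elim (¬p (c , pc))

zeroRunAt : ∀ {n} (v : Fin n → Bool) z → v z ≡ false →
            ∃[ a ] ∃[ b ] (IsZeroRun v (a , b) × a Fin.≤ z × z Fin.≤ b)
zeroRunAt v z vz
  with a , (a≤z , az) , minimal ← least (λ a → (a Fin.≤? z) ×-dec allZero? v a z)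
         (z , ≤-refl , λ j z≤j j≤z → trans (cong v (Fin.≤-antisym j≤z z≤j)) vz)
     | b , (z≤b , zb) , maximal ← greatest (λ b → (z Fin.≤? b) ×-dec allZero? v z b)
         (z , ≤-refl , λ j z≤j j≤z → trans (cong v (Fin.≤-antisym j≤z z≤j)) vz)
  = a , b
  , (≤-trans a≤z z≤b , both
    , λ a′ b′ a′≤a b≤b′ zeros →
        Fin.≤-antisym a′≤a (minimal a′ (≤-trans a′≤a a≤z , λ j a′≤j j≤z →
          zeros j a′≤j (≤-trans j≤z (≤-trans z≤b b≤b′))))
      , Fin.≤-antisym (maximal b′ (≤-trans z≤b b≤b′ , λ j z≤j j≤b′ →
          zeros j (≤-trans a′≤a (≤-trans a≤z z≤j)) j≤b′)) b≤b′)
  , a≤z , z≤b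
  where
  both : AllZero v a b
  both j a≤j j≤b with ≤-total (toℕ j) (toℕ z)
  ... | inj₁ j≤z = az j a≤j j≤z
  ... | inj₂ z≤j = zb j z≤j j≤b

-- Each `z t` lies in a zero run, and the 1-entry `s t′` separates the run of `z t′` from those of
-- all earlier `z t`. Sending `t` to the position of its run in the filtered list is therefore
-- injective.
complexity-≥ : ∀ {n B} (v : Fin n → Bool) (z s : Fin B → Fin n) →
  (∀ t → v (z t) ≡ false) → (∀ t → v (s t) ≡ true) →
  (∀ {t t′} → t Fin.< t′ → z t Fin.< s t′) → (∀ t → s t Fin.< z t) →
  B ≤ complexity v
complexity-≥ {n} {B} v z s vz vs z<next s<z = Fin.injective⇒≤ {f = index ∘ run∈} injective
  where
  run : Fin B → Fin n × Fin n
  run t = let a , b , _ = zeroRunAt v (z t) (vz t) in a , b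

  isRun : ∀ t → IsZeroRun v (run t)
  isRun t = let _ , _ , r , _ = zeroRunAt v (z t) (vz t) in r

  start≤ : ∀ t → proj₁ (run t) Fin.≤ z t
  start≤ t = let _ , _ , _ , a≤z , _ = zeroRunAt v (z t) (vz t) in a≤z

  ≤end : ∀ t → z t Fin.≤ proj₂ (run t)
  ≤end t = let _ , _ , _ , _ , z≤b = zeroRunAt v (z t) (vz t) in z≤b

  run∈ : ∀ t → run t ∈ _
  run∈ t = ∈-filter⁺ (isZeroRun? v)
    (∈-cartesianProduct⁺ (∈-allFin (proj₁ (run t))) (∈-allFin (proj₂ (run t)))) (isRun t)

  distinct : ∀ {t t′} → t Fin.< t′ → run t ≢ run t′
  distinct {t} {t′} t<t′ eq with () ← trans (sym (vs t′))
    (proj₁ (proj₂ (isRun t)) (s t′)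
      (≤-trans (start≤ t) (<⇒≤ (z<next t<t′)))
      (≤-trans (<⇒≤ (s<z t′)) (subst (λ r → z t′ Fin.≤ proj₂ r) (sym eq) (≤end t′))))

  injective : ∀ {t t′} → index (run∈ t) ≡ index (run∈ t′) → t ≡ t′
  injective {t} {t′} eq with Membershipₛ.index-injective (setoid _) (run∈ t) (run∈ t′) eq
                           | <-cmp (toℕ t) (toℕ t′)
  ... | same | tri< t<t′ _ _ = ⊥-elim (distinct t<t′ same)
  ... | same | tri≈ _ t≡t′ _ = Fin.toℕ-injective t≡t′
  ... | same | tri> _ _ t>t′ = ⊥-elim (distinct t>t′ (sym same))

complexity≤maxRowComplexity : ∀ {m n} (M : Matrix m n) i → complexity (M i) ≤ maxRowComplexity M
complexity≤maxRowComplexity M i = v≤max⁺ 0 _ (inj₂ (lose (∈-map⁺ _ (∈-allFin i)) ≤-refl))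

-- Entrywise order on matrices and the change of one entry.

infix 4 _⊑_

_⊑_ : ∀ {m n} → Matrix m n → Matrix m n → Set
M ⊑ M′ = ∀ i j → M i j ≡ true → M′ i j ≡ true

≼-mono : ∀ {k ℓ m n} {P : Matrix k ℓ} {M M′ : Matrix m n} → M ⊑ M′ → P ≼ M → P ≼ M′
≼-mono M⊑M′ (r , c , f) = r , c , λ i j pij →
  let x , y , x∈ , y∈ , mxy = f i j pij in x , y , x∈ , y∈ , M⊑M′ x y mxy

module _ {m n : ℕ} (M : Matrix m n) (i : Fin m) (j : Fin n) where

  setOne-new : setOne M i j i j ≡ true
  setOne-new = trans (cong (λ row → row j) (updateAt-updates i M)) (updateAt-updates j (M i))

  setOne-old : M ⊑ setOne M i j
  setOne-old x y mxy with x Fin.≟ i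
  ... | no x≢i = trans (cong (λ row → row y) (updateAt-minimal x i M x≢i)) mxy
  ... | yes refl with y Fin.≟ j
  ...   | yes refl = setOne-new
  ...   | no y≢j = trans (cong (λ row → row y) (updateAt-updates i M))
                         (trans (updateAt-minimal y j (M i) y≢j) mxy)

  setOne-⊑ : ∀ {M′} → M ⊑ M′ → M′ i j ≡ true → setOne M i j ⊑ M′
  setOne-⊑ M⊑M′ new x y eq with x Fin.≟ i
  ... | no x≢i = M⊑M′ x y (trans (sym (cong (λ row → row y) (updateAt-minimal x i M x≢i))) eq)
  ... | yes refl with y Fin.≟ j
  ...   | yes refl = new
  ...   | no y≢j = M⊑M′ x y (trans (sym (updateAt-minimal y j (M i) y≢j))
                       (trans (sym (cong (λ row → row y) (updateAt-updates i M))) eq))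

-- Decidability of containment, and distances forced by cuts.

anyVec? : ∀ {m} k {Q : Vec (Fin m) k → Set} → Decidable Q → Dec (∃ Q)
anyVec? zero    Q? = map′ ([] ,_) (λ { ([] , q) → q }) (Q? [])
anyVec? (suc k) Q? =
  map′ (λ (x , v , q) → x ∷ v , q) (λ { (x ∷ v , q) → x , v , q })
       (Fin.any? λ x → anyVec? k (Q? ∘ (x ∷_)))

module _ {k m : ℕ} where

  -- `Cuts` holds a function into all naturals, but its values never exceed `m`. Encoding them as
  -- vectors over `Fin (suc m)` leaves finitely many candidates, so that `_≼?_` can be an exhaustive
  -- search.
  IsCuts : Vec (Fin (suc m)) (suc k) → Set
  IsCuts v = toℕ (lookup v zero) ≡ 0 × toℕ (lookup v (fromℕ k)) ≡ m ×
    (∀ i → toℕ (lookup v (inject₁ i)) < toℕ (lookup v (suc i)))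

  isCuts? : Decidable IsCuts
  isCuts? v = (_ ≟ _) ×-dec ((_ ≟ _) ×-dec (Fin.all? λ _ → _ <? _))

  fromVec : ∀ v → IsCuts v → Cuts k m
  fromVec v (first , last , increasing) = record
    { cut = toℕ ∘ lookup v ; first = first ; last = last ; increasing = increasing }

module _ {k m : ℕ} (r : Cuts k m) where
  open Cuts r

  -- Consecutive cuts differ by at least 1. All size estimates for copies of a pattern rest on this.
  cut-+ : ∀ δ (a b : Fin (suc k)) → toℕ a + δ ≡ toℕ b → cut a + δ ≤ cut b
  cut-+ zero a b a≡b = ≤-reflexive (trans (+-identityʳ _)
    (cong cut (Fin.toℕ-injective (trans (sym (+-identityʳ _)) a≡b))))
  cut-+ (suc δ) a zero eq with () ← trans (sym (+-suc (toℕ a) δ)) eq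
  cut-+ (suc δ) a (suc b) eq = begin
    cut a + suc δ         ≡⟨ +-suc (cut a) δ ⟩
    suc (cut a + δ)       ≤⟨ s≤s (cut-+ δ a (inject₁ b) (trans
                               (suc-injective (trans (sym (+-suc (toℕ a) δ)) eq))
                               (sym (Fin.toℕ-inject₁ b)))) ⟩
    suc (cut (inject₁ b)) ≤⟨ increasing b ⟩
    cut (suc b)           ∎
    where open ≤-Reasoning

  cut≤ : ∀ i → cut i ≤ m
  cut≤ i = subst (cut i ≤_) last (m+n≤o⇒m≤o (cut i) (cut-+ (k ∸ toℕ i) i (fromℕ k)
    (trans (m+[n∸m]≡n (s≤s⁻¹ (Fin.toℕ<n i))) (sym (Fin.toℕ-fromℕ k)))))

  toVec : Vec (Fin (suc m)) (suc k)
  toVec = tabulate λ i → fromℕ< (s≤s (cut≤ i))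

  toVec≡ : ∀ i → toℕ (lookup toVec i) ≡ cut i
  toVec≡ i = trans (cong toℕ (lookup∘tabulate (λ j → fromℕ< (s≤s (cut≤ j))) i)) (Fin.toℕ-fromℕ< _)

  toVec-isCuts : IsCuts toVec
  toVec-isCuts = trans (toVec≡ zero) first , trans (toVec≡ (fromℕ k)) last ,
    λ i → subst₂ _<_ (sym (toVec≡ (inject₁ i))) (sym (toVec≡ (suc i))) (increasing i)

  ∈-toVec : ∀ {x i} → x ∈[ r ] i → x ∈[ fromVec toVec toVec-isCuts ] i
  ∈-toVec {x} {i} (l , u) = subst (_≤ toℕ x) (sym (toVec≡ (inject₁ i))) l ,
                            subst (toℕ x <_) (sym (toVec≡ (suc i))) u

  -- The `δ - 1` intervals strictly between those of `i` and `i′` are nonempty, so a copy never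
  -- brings two lines closer than they are in the pattern.
  ∈-gap : ∀ {x x′ i i′ δ} → toℕ i + δ ≡ toℕ i′ → 0 < δ →
          x ∈[ r ] i → x′ ∈[ r ] i′ → toℕ x + δ ≤ toℕ x′
  ∈-gap {x} {x′} {i} {i′} {suc δ} eq 0<δ (_ , x<) (≤x′ , _) = begin
    toℕ x + suc δ   ≡⟨ +-suc (toℕ x) δ ⟩
    suc (toℕ x) + δ ≤⟨ +-monoˡ-≤ δ x< ⟩
    cut (suc i) + δ ≤⟨ cut-+ δ (suc i) (inject₁ i′)
                         (trans (sym (+-suc (toℕ i) δ)) (trans eq (sym (Fin.toℕ-inject₁ i′)))) ⟩
    cut (inject₁ i′) ≤⟨ ≤x′ ⟩
    toℕ x′          ∎
    where open ≤-Reasoning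

  ∈-lower : ∀ {x i} → x ∈[ r ] i → toℕ i ≤ toℕ x
  ∈-lower {x} {i} (≤x , _) = ≤-trans
    (subst (λ c → c + toℕ i ≤ cut (inject₁ i)) first
      (cut-+ (toℕ i) zero (inject₁ i) (sym (Fin.toℕ-inject₁ i)))) ≤x

  ∈-upper : ∀ {x i q} → suc (toℕ i) + q ≡ k → x ∈[ r ] i → toℕ x + q < m
  ∈-upper {x} {i} {q} eq (_ , x<) = begin
    suc (toℕ x) + q ≤⟨ +-monoˡ-≤ q x< ⟩
    cut (suc i) + q ≤⟨ cut-+ q (suc i) (fromℕ k) (trans eq (sym (Fin.toℕ-fromℕ k))) ⟩
    cut (fromℕ k)   ≡⟨ last ⟩
    m               ∎
    where open ≤-Reasoning

infix 4 _∈?[_]_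

_∈?[_]_ : ∀ {k m} (x : Fin m) (r : Cuts k m) i → Dec (x ∈[ r ] i)
x ∈?[ r ] i = (_ ≤? _) ×-dec (_ <? _)

infix 4 _≼?_

_≼?_ : ∀ {k ℓ m n} (P : Matrix k ℓ) (M : Matrix m n) → Dec (P ≼ M)
_≼?_ {k} {ℓ} {m} {n} P M = map′ from to
  (anyVec? (suc k) λ v → anyVec? (suc ℓ) λ w → contained? v w)
  where
  ContainedBy : Cuts k m → Cuts ℓ n → Set
  ContainedBy r c = ∀ i j → P i j ≡ true →
    ∃[ x ] ∃[ y ] (x ∈[ r ] i × y ∈[ c ] j × M x y ≡ true)

  Contained : Vec (Fin (suc m)) (suc k) → Vec (Fin (suc n)) (suc ℓ) → Set
  Contained v w = ∃[ r ] ∃[ c ] ContainedBy (fromVec v r) (fromVec w c)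

  containedBy? : ∀ r c → Dec (ContainedBy r c)
  containedBy? r c = Fin.all? λ i → Fin.all? λ j → (P i j Bool.≟ true) →-dec
    (Fin.any? λ x → Fin.any? λ y →
      (x ∈?[ r ] i) ×-dec ((y ∈?[ c ] j) ×-dec (M x y Bool.≟ true)))

  contained? : ∀ v w → Dec (Contained v w)
  contained? v w with isCuts? v | isCuts? w
  ... | no ¬r | _     = no λ (r , _) → ¬r r
  ... | yes _ | no ¬c = no λ (_ , c , _) → ¬c c
  ... | yes r | yes c = map′ (λ f → r , c , f) (λ (_ , _ , f) → f)
                            (containedBy? (fromVec v r) (fromVec w c))

  from : ∃[ v ] ∃[ w ] Contained v w → P ≼ M
  from (v , w , r , c , f) = fromVec v r , fromVec w c , f

  to : P ≼ M → ∃[ v ] ∃[ w ] Contained v w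
  to (r , c , f) = toVec r , toVec c , toVec-isCuts r , toVec-isCuts c , λ i j pij →
    let x , y , x∈ , y∈ , mxy = f i j pij in x , y , ∈-toVec r x∈ , ∈-toVec c y∈ , mxy

-- Extension of an avoiding matrix to a critical one.

Blocked : ∀ {k ℓ m n} → Matrix k ℓ → Matrix m n → Fin m × Fin n → Set
Blocked P M (i , j) = M i j ≡ false → P ≼ setOne M i j

-- Each position in turn becomes a 1-entry unless this creates `P`. A rejected position stays
-- blocked after later changes because containment is monotone; an accepted one is blocked
-- vacuously, being a 1-entry of every later matrix.
saturate : ∀ {k ℓ m n} (P : Matrix k ℓ) (M : Matrix m n) → ¬ P ≼ M → ∀ ps →
           ∃[ M′ ] (M ⊑ M′ × ¬ P ≼ M′ × All (Blocked P M′) ps)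
saturate P M avoids [] = M , (λ _ _ → id) , avoids , []
saturate P M avoids ((i , j) ∷ ps) with P ≼? setOne M i j
... | yes contains =
  let M′ , M⊑M′ , avoids′ , blocked = saturate P M avoids ps
  in M′ , M⊑M′ , avoids′
   , (λ _ → ≼-mono (setOne-⊑ M i j (λ x y → setOne-old M′ i j x y ∘ M⊑M′ x y)
                               (setOne-new M′ i j)) contains)
     ∷ blocked
... | no avoids₁ =
  let M′ , M₁⊑M′ , avoids′ , blocked = saturate P (setOne M i j) avoids₁ ps
  in M′ , (λ x y → M₁⊑M′ x y ∘ setOne-old M i j x y) , avoids′
   , (λ zero′ → ⊥-elim (true≢false (trans (sym (M₁⊑M′ i j (setOne-new M i j))) zero′)))
     ∷ blocked
  where
  true≢false : true ≢ false
  true≢false ()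

criticalAbove : ∀ {k ℓ m n} (P : Matrix k ℓ) (M : Matrix m n) → ¬ P ≼ M →
                ∃[ M′ ] (M ⊑ M′ × Critical (Av P) M′)
criticalAbove {m = m} {n} P M avoids =
  let M′ , M⊑M′ , avoids′ , blocked =
        saturate P M avoids (cartesianProduct (allFin m) (allFin n))
  in M′ , M⊑M′ , avoids′ , λ i j zero′ avoids″ → avoids″
       (All-lookup blocked (∈-cartesianProduct⁺ (∈-allFin i) (∈-allFin j)) zero′)

-- An avoiding matrix above `M` has no 1-entry at `(i , z t)`, since it would lie above
-- `setOne M i (z t)`. A critical extension thus keeps these zeros along with the 1-entries at
-- `s t`, whatever else it adds.
criticalRow : ∀ {k ℓ m n B} (P : Matrix k ℓ) (M : Matrix m n) → ¬ P ≼ M →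
  (i : Fin m) (z s : Fin B → Fin n) →
  (∀ t → P ≼ setOne M i (z t)) → (∀ t → M i (s t) ≡ true) →
  (∀ {t t′} → t Fin.< t′ → z t Fin.< s t′) → (∀ t → s t Fin.< z t) →
  ∃[ M′ ] (Critical (Av P) M′ × B ≤ complexity (M′ i))
criticalRow P M avoids i z s forced ones z<next s<z =
  let M′ , M⊑M′ , critical = criticalAbove P M avoids
      zeros = λ t → Bool.¬-not λ one → proj₁ critical
        (≼-mono (setOne-⊑ M i (z t) M⊑M′ one) (forced t))
  in M′ , critical
   , complexity-≥ (M′ i) z s zeros (λ t → M⊑M′ i (s t) (ones t)) z<next s<z

-- Copies of a pattern with inserted rows or columns.

module _ {k m : ℕ} (f : ℕ → ℕ) (f-mono : ∀ {i j} → i < j → f i < f j)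
         (0<k : 0 < k) (f-end : f k ≡ m) where

  -- Line `i` of the pattern is represented by line `f i`, the one just after a cut. The first cut
  -- has to be 0 even where `f 0` is positive; the lines before `f 0` then join the first interval.
  cutAt : ℕ → ℕ
  cutAt zero    = 0
  cutAt (suc i) = f (suc i)

  cutAt≤ : ∀ i → cutAt i ≤ f i
  cutAt≤ zero    = z≤n
  cutAt≤ (suc i) = ≤-refl

  cutsAt : Cuts k m
  cutsAt = record
    { cut        = cutAt ∘ toℕ
    ; first      = refl
    ; last       = trans (cong cutAt (Fin.toℕ-fromℕ k)) (end 0<k)
    ; increasing = λ i → ≤-<-trans (cutAt≤ (toℕ (inject₁ i)))
        (subst (λ j → f j < f (suc (toℕ i))) (sym (Fin.toℕ-inject₁ i)) (f-mono (n<1+n (toℕ i))))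
    }
    where
    end : 0 < k → cutAt k ≡ m
    end (s≤s _) = f-end

  ∈-cutsAt : ∀ {x} i → toℕ x ≡ f (toℕ i) → x ∈[ cutsAt ] i
  ∈-cutsAt {x} i x≡ =
      ≤-trans (cutAt≤ (toℕ (inject₁ i)))
        (≤-reflexive (trans (cong f (Fin.toℕ-inject₁ i)) (sym x≡)))
    , ≤-<-trans (≤-reflexive x≡) (f-mono (n<1+n (toℕ i)))

step : ℕ → ℕ → ℕ → ℕ
step a s i with a ≤? i
... | yes _ = s
... | no _  = 0

step-before : ∀ {a} s {i} → i < a → step a s i ≡ 0
step-before {a} s {i} i<a with a ≤? i
... | yes a≤i = ⊥-elim (<⇒≱ i<a a≤i)
... | no _    = refl

step-after : ∀ {a} s {i} → a ≤ i → step a s i ≡ s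
step-after {a} s {i} a≤i with a ≤? i
... | yes _  = refl
... | no a≰i = ⊥-elim (a≰i a≤i)

step-mono : ∀ a s {i j} → i ≤ j → step a s i ≤ step a s j
step-mono a s {i} {j} i≤j with a ≤? i
... | yes a≤i = ≤-reflexive (sym (step-after s (≤-trans a≤i i≤j)))
... | no _    = z≤n

+-swapʳ : ∀ a b c → a + b + c ≡ a + c + b
+-swapʳ = solve-∀

-- Inserts σ new lines before line α and σ′ new lines after line α + η - 1.
spread : (α η σ σ′ i : ℕ) → ℕ
spread α η σ σ′ i = i + (step α σ i + step (α + η) σ′ i)

module _ (α η σ σ′ : ℕ) where

  spread-mono : ∀ {i j} → i < j → spread α η σ σ′ i < spread α η σ σ′ j
  spread-mono i<j = +-mono-<-≤ i<j
    (+-mono-≤ (step-mono α σ (<⇒≤ i<j)) (step-mono (α + η) σ′ (<⇒≤ i<j)))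

  spread-before : ∀ {i} → i < α → spread α η σ σ′ i ≡ i
  spread-before {i} i<α = trans
    (cong₂ (λ a b → i + (a + b)) (step-before σ i<α)
      (step-before σ′ (<-≤-trans i<α (m≤m+n α η))))
    (+-identityʳ i)

  spread-within : ∀ {a} → a < η → spread α η σ σ′ (α + a) ≡ α + σ + a
  spread-within {a} a<η = trans
    (cong₂ (λ b c → α + a + (b + c)) (step-after σ (m≤m+n α a))
      (step-before σ′ (+-monoʳ-< α a<η)))
    (trans (cong (α + a +_) (+-identityʳ σ)) (+-swapʳ α a σ))

  spread-after : ∀ {i} → α + η ≤ i → spread α η σ σ′ i ≡ i + (σ + σ′)
  spread-after {i} ≤i = cong₂ (λ a b → i + (a + b))
    (step-after σ (≤-trans (m≤m+n α η) ≤i)) (step-after σ′ ≤i)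

  spread-after-≥ : ∀ {i} → α + η ≤ i → α + η + (σ + σ′) ≤ spread α η σ σ′ i
  spread-after-≥ ≤i = ≤-trans (+-monoˡ-≤ (σ + σ′) ≤i) (≤-reflexive (sym (spread-after ≤i)))

-- The staircase matrix: avoidance, forced zeros and critical extensions.

does⇒ : ∀ {A : Set} (A? : Dec A) → does A? ≡ true → A
does⇒ (yes a) _ = a

-- Blocks t = 0, …, B - 1 climb from bottom left to top right.  The margins of
-- widths p, q, u, v absorb the rows and columns of P outside the occurrence.
module Staircase (p d e q u g g′ v B : ℕ) (0<d : 0 < d) (0<g : 0 < g) where

  h w : ℕ
  h = suc e
  w = suc (g + g′)

  -- Blocks are numbered from the left but climb, hence the reversed index `B ∸ suc t`: block 0 ends
  -- just above row `bottom`, and block `B - 1` starts at row `p + d`, directly below the band.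
  top left : ℕ → ℕ
  top t  = p + d + (B ∸ suc t) * h
  left t = u + t * w

  bottom right : ℕ
  bottom = p + d + B * h
  right  = u + B * w

  Hole : ℕ → Set
  Hole y = ∃[ t ] (t < B × y ≡ left t + g)

  InBlock : ℕ → ℕ → ℕ → Set
  InBlock t x y = (top t ≤ x × x < top t + h) × (left t ≤ y × y < left t + w)

  Margin Inner One : ℕ → ℕ → Set
  Margin x y = (x < p ⊎ bottom ≤ x) ⊎ (y < u ⊎ right ≤ y)
  Inner x y  = (x < p + d × ¬ Hole y) ⊎ (∃[ t ] (t < B × InBlock t x y))
  One x y    = Margin x y ⊎ Inner x y

  one? : ∀ x y → Dec (One x y)
  one? x y = (((x <? p) ⊎-dec (bottom ≤? x)) ⊎-dec ((y <? u) ⊎-dec (right ≤? y)))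
    ⊎-dec ((x <? p + d) ×-dec ¬? (anyUpTo? (λ t → y ≟ left t + g) B))
    ⊎-dec anyUpTo? (λ t → ((top t ≤? x) ×-dec (x <? top t + h)) ×-dec
                          ((left t ≤? y) ×-dec (y <? left t + w))) B

  M : Matrix (bottom + q) (right + v)
  M x y = does (one? (toℕ x) (toℕ y))

  left-< : ∀ {t s} → t < s → left t + w ≤ left s
  left-< {t} {s} t<s = begin
    u + t * w + w   ≡⟨ +-assoc u (t * w) w ⟩
    u + (t * w + w) ≡⟨ cong (u +_) (+-comm (t * w) w) ⟩
    u + suc t * w   ≤⟨ +-monoʳ-≤ u (*-monoˡ-≤ w t<s) ⟩
    u + s * w       ∎
    where open ≤-Reasoning

  top-< : ∀ {t s} → t < s → s < B → top s + h ≤ top t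
  top-< {t} {s} t<s s<B = begin
    p + d + (B ∸ suc s) * h + h   ≡⟨ +-assoc (p + d) ((B ∸ suc s) * h) h ⟩
    p + d + ((B ∸ suc s) * h + h) ≡⟨ cong (p + d +_) (+-comm ((B ∸ suc s) * h) h) ⟩
    p + d + suc (B ∸ suc s) * h   ≤⟨ +-monoʳ-≤ (p + d) (*-monoˡ-≤ h (∸-monoʳ-< (s≤s t<s) s<B)) ⟩
    p + d + (B ∸ suc t) * h       ∎
    where open ≤-Reasoning

  top-≤-bottom : ∀ {t} → t < B → top t + h ≤ bottom
  top-≤-bottom {t} t<B = begin
    p + d + (B ∸ suc t) * h + h   ≡⟨ +-assoc (p + d) ((B ∸ suc t) * h) h ⟩
    p + d + ((B ∸ suc t) * h + h) ≡⟨ cong (p + d +_) (+-comm ((B ∸ suc t) * h) h) ⟩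
    p + d + suc (B ∸ suc t) * h   ≤⟨ +-monoʳ-≤ (p + d) (*-monoˡ-≤ h (∸-monoʳ-< {B} {suc t} {0} z<s t<B)) ⟩
    p + d + B * h                 ∎
    where open ≤-Reasoning

  sameBlock : ∀ {t s y} → left t ≤ y → y < left t + w → left s ≤ y → y < left s + w → t ≡ s
  sameBlock {t} {s} t≤ <t s≤ <s with <-cmp t s
  ... | tri< t<s _ _ = ⊥-elim (<⇒≱ <t (≤-trans (left-< t<s) s≤))
  ... | tri≈ _ t≡s _ = t≡s
  ... | tri> _ _ t>s = ⊥-elim (<⇒≱ <s (≤-trans (left-< t>s) t≤))

  g<w : g < w
  g<w = s≤s (m≤m+n g g′)

  hole-block : ∀ {t a} → a < w → Hole (left t + a) → a ≡ g
  hole-block {t} {a} a<w (s , s<B , eq) = +-cancelˡ-≡ (left t) a g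
    (trans eq (cong (λ r → left r + g) (sym (sameBlock {t} {s}
      (m≤m+n (left t) a) (+-monoʳ-< (left t) a<w)
      (subst (left s ≤_) (sym eq) (m≤m+n (left s) g))
      (subst (_< left s + w) (sym eq) (+-monoʳ-< (left s) g<w))))))

  inner : ∀ {x y} → p ≤ x → x < bottom → u ≤ y → y < right → One x y → Inner x y
  inner p≤x x< u≤y y< (inj₁ (inj₁ (inj₁ x<p))) = ⊥-elim (<⇒≱ x<p p≤x)
  inner p≤x x< u≤y y< (inj₁ (inj₁ (inj₂ ≤x)))  = ⊥-elim (<⇒≱ x< ≤x)
  inner p≤x x< u≤y y< (inj₁ (inj₂ (inj₁ y<u))) = ⊥-elim (<⇒≱ y<u u≤y)
  inner p≤x x< u≤y y< (inj₁ (inj₂ (inj₂ ≤y)))  = ⊥-elim (<⇒≱ y< ≤y)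
  inner p≤x x< u≤y y< (inj₂ i) = i

  low-inner : ∀ {x y} → p + d ≤ x → Inner x y → ∃[ t ] (t < B × InBlock t x y)
  low-inner ≤x (inj₁ (x< , _)) = ⊥-elim (<⇒≱ x< ≤x)
  low-inner ≤x (inj₂ b) = b

  -- `o₁` and `o₂` lie below the band, hence in blocks `t` and `s`. The second position is neither
  -- above nor left of the first, whereas of two different blocks the one further right is higher;
  -- so `t ≡ s`.
  noPattern : ∀ {x₀ x₁ x₂ y₀ y₁ y₂} →
    p ≤ x₀ → x₀ + d ≤ x₁ → x₁ + e ≤ x₂ → x₂ < bottom →
    u ≤ y₁ → y₁ + g ≤ y₀ → y₀ + g′ ≤ y₂ → y₂ < right →
    One x₀ y₀ → One x₁ y₁ → One x₂ y₂ → ⊥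
  noPattern {x₀} {x₁} {x₂} {y₀} {y₁} {y₂} p≤x₀ x₀₁ x₁₂ x₂< u≤y₁ y₁₀ y₀₂ y₂< o₀ o₁ o₂
    with low-inner (≤-trans (+-monoˡ-≤ d p≤x₀) x₀₁)
           (inner p≤x₁ (≤-<-trans x₁≤x₂ x₂<) u≤y₁ (≤-<-trans y₁≤y₂ y₂<) o₁)
       | low-inner (≤-trans (+-monoˡ-≤ d p≤x₀) (≤-trans x₀₁ x₁≤x₂))
           (inner (≤-trans p≤x₁ x₁≤x₂) x₂< (≤-trans u≤y₁ y₁≤y₂) y₂< o₂)
    where
    x₁≤x₂ = m+n≤o⇒m≤o x₁ x₁₂
    p≤x₁  = ≤-trans p≤x₀ (m+n≤o⇒m≤o x₀ x₀₁)
    y₁≤y₂ = ≤-trans (m+n≤o⇒m≤o y₁ y₁₀) (m+n≤o⇒m≤o y₀ y₀₂)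
  ... | t , t<B , (t≤x₁ , x₁<t) , (t≤y₁ , y₁<t) | s , s<B , (s≤x₂ , x₂<s) , (s≤y₂ , y₂<s)
    with <-cmp t s
  ... | tri< t<s _ _ = <⇒≱ x₂<s (≤-trans (top-< t<s s<B) (≤-trans t≤x₁ (m+n≤o⇒m≤o x₁ x₁₂)))
  ... | tri> _ _ s<t = <⇒≱ y₂<s (≤-trans (left-< s<t) (≤-trans t≤y₁
                         (≤-trans (m+n≤o⇒m≤o y₁ y₁₀) (m+n≤o⇒m≤o y₀ y₀₂))))
  ... | tri≈ _ refl _ = upper (inner p≤x₀ (≤-<-trans x₀≤x₂ x₂<)
                          (≤-trans u≤y₁ (m+n≤o⇒m≤o y₁ y₁₀)) (≤-<-trans (m+n≤o⇒m≤o y₀ y₀₂) y₂<) o₀)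
    where
    x₀≤x₂ = ≤-trans (m+n≤o⇒m≤o x₀ x₀₁) (m+n≤o⇒m≤o x₁ x₁₂)

    -- The distances `g` and `g′` fill the block width `g + g′ + 1` exactly, which pins `y₀` from
    -- both sides.
    y₀≡ : y₀ ≡ left t + g
    y₀≡ = ≤-antisym
      (+-cancelʳ-≤ g′ y₀ (left t + g) (≤-trans y₀₂ (s≤s⁻¹
        (subst (y₂ <_) (trans (+-suc (left t) (g + g′)) (cong suc (sym (+-assoc (left t) g g′)))) y₂<s))))
      (≤-trans (+-monoˡ-≤ g t≤y₁) y₁₀)

    upper : Inner x₀ y₀ → ⊥
    upper (inj₁ (_ , ¬hole)) = ¬hole (t , t<B , y₀≡)
    -- By its column, a block containing this entry is block `t` again. But rows at distances `d`
    -- and `e` span at least `e + 2` rows, one more than the block has.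
    upper (inj₂ (r , r<B , (r≤x₀ , _) , (r≤y₀ , y₀<r)))
      with refl ← sameBlock {t} {r}
        (subst (left t ≤_) (sym y₀≡) (m≤m+n (left t) g))
        (subst (_< left t + w) (sym y₀≡) (+-monoʳ-< (left t) g<w)) r≤y₀ y₀<r
      = <⇒≱ x₂<s (begin
          top t + suc e ≡⟨ +-assoc (top t) 1 e ⟨
          top t + 1 + e ≤⟨ +-monoˡ-≤ e (+-mono-≤ r≤x₀ 0<d) ⟩
          x₀ + d + e    ≤⟨ +-monoˡ-≤ e x₀₁ ⟩
          x₁ + e        ≤⟨ x₁₂ ⟩
          x₂            ∎)
      where open ≤-Reasoning

  module _ {k ℓ} (P : Matrix k ℓ) {r₁ r₂ r₃ : Fin k} {c₁ c₂ c₃ : Fin ℓ}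
    (r₁≡ : toℕ r₁ ≡ p) (r₂≡ : toℕ r₂ ≡ p + d) (r₃≡ : toℕ r₃ ≡ p + d + e)
    (c₁≡ : toℕ c₁ ≡ u) (c₂≡ : toℕ c₂ ≡ u + g) (c₃≡ : toℕ c₃ ≡ u + g + g′)
    (k≡ : k ≡ p + d + h + q) (ℓ≡ : ℓ ≡ u + w + v) where

    -- `∈-gap` carries the distances in `P` over to the copy, while `∈-lower` and `∈-upper` keep the
    -- three entries out of the margins, because the copy needs room for the other lines of `P` on
    -- every side.
    avoids : 0 < e → 0 < g′ →
      P r₁ c₂ ≡ true → P r₂ c₁ ≡ true → P r₃ c₃ ≡ true → ¬ P ≼ M
    avoids 0<e 0<g′ p₁₂ p₂₁ p₃₃ (r , c , f)
      with x₀ , y₀ , x₀∈ , y₀∈ , o₀ ← f r₁ c₂ p₁₂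
         | x₁ , y₁ , x₁∈ , y₁∈ , o₁ ← f r₂ c₁ p₂₁
         | x₂ , y₂ , x₂∈ , y₂∈ , o₂ ← f r₃ c₃ p₃₃
      = noPattern
          (subst (_≤ toℕ x₀) r₁≡ (∈-lower r x₀∈))
          (∈-gap r (trans (cong (_+ d) r₁≡) (sym r₂≡)) 0<d x₀∈ x₁∈)
          (∈-gap r (trans (cong (_+ e) r₂≡) (sym r₃≡)) 0<e x₁∈ x₂∈)
          (+-cancelʳ-< q _ _ (∈-upper r (trans (cong (λ i → suc i + q) r₃≡)
            (trans (cong (_+ q) (sym (+-suc (p + d) e))) (sym k≡))) x₂∈))
          (subst (_≤ toℕ y₁) c₁≡ (∈-lower c y₁∈))
          (∈-gap c (trans (cong (_+ g) c₁≡) (sym c₂≡)) 0<g y₁∈ y₀∈)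
          (∈-gap c (trans (cong (_+ g′) c₂≡) (sym c₃≡)) 0<g′ y₀∈ y₂∈)
          (+-cancelʳ-< v _ _ (∈-upper c (trans (cong (λ j → suc j + v) c₃≡)
            (trans (cong (_+ v) (trans (cong suc (+-assoc u g g′)) (sym (+-suc u (g + g′)))))
              (sym ℓ≡))) y₂∈))
          (does⇒ (one? _ _) o₀) (does⇒ (one? _ _) o₁) (does⇒ (one? _ _) o₂)

    -- The copy stretches `P` so that rows `r₂` to `r₃` and columns `c₁` to `c₃` fall exactly on
    -- block `t`, while rows above `r₂` stay in place. The only 1-entry that can land on a 0-entry
    -- of `M` is `(r₁ , c₂)`, and it lands on the new 1-entry.
    contains : ∀ {t} → t < B →
      (∀ i → P i c₂ ≡ true → toℕ i < p + d → toℕ i ≤ p) →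
      (i : Fin (bottom + q)) (j : Fin (right + v)) → toℕ i ≡ p → toℕ j ≡ left t + g →
      P ≼ setOne M i j
    contains {t} t<B lowest i₀ j₀ i₀≡ j₀≡ =
      cutsAt ρ ρ-mono 0<k ρ-end , cutsAt γ γ-mono 0<ℓ γ-end ,
      λ i j pij → let x = fromℕ< (ρ< i) ; y = fromℕ< (γ< j)
                      x≡ = Fin.toℕ-fromℕ< (ρ< i) ; y≡ = Fin.toℕ-fromℕ< (γ< j) in
        x , y , ∈-cutsAt ρ ρ-mono 0<k ρ-end i x≡
              , ∈-cutsAt γ γ-mono 0<ℓ γ-end j y≡
              , [ (λ one → setOne-old M i₀ j₀ x y (dec-true (one? _ _) (subst₂ One (sym x≡) (sym y≡) one)))
                , (λ (ρ≡ , γ≡) → subst₂ (λ a b → setOne M i₀ j₀ a b ≡ true)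
                     (Fin.toℕ-injective (trans i₀≡ (trans (sym ρ≡) (sym x≡))))
                     (Fin.toℕ-injective (trans j₀≡ (trans (sym γ≡) (sym y≡))))
                     (setOne-new M i₀ j₀)) ]′ (image i j pij)
      where
      t′ : ℕ
      t′ = B ∸ suc t

      ρ γ : ℕ → ℕ
      -- The `t′` later blocks lie above and to the right of block `t`, the `t` earlier ones below
      -- and to the left; the inserted lines skip them.
      ρ = spread (p + d) h (t′ * h) (t * h)
      γ = spread u w (t * w) (t′ * w)

      B≡ : B ≡ suc t + t′
      B≡ = sym (m+[n∸m]≡n t<B)

      regroup : ∀ a t t′ h → a + h + (t′ * h + t * h) ≡ a + (suc t + t′) * h
      regroup = solve-∀

      ρ-shift : p + d + h + (t′ * h + t * h) ≡ bottom
      ρ-shift = trans (regroup (p + d) t t′ h) (cong (λ b → p + d + b * h) (sym B≡))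

      γ-shift : u + w + (t * w + t′ * w) ≡ right
      γ-shift = trans (cong (u + w +_) (+-comm (t * w) (t′ * w)))
        (trans (regroup u t t′ w) (cong (λ b → u + b * w) (sym B≡)))

      ρ-end : ρ k ≡ bottom + q
      ρ-end = trans (cong ρ k≡) (trans (spread-after (p + d) h (t′ * h) (t * h) (m≤m+n (p + d + h) q))
        (trans (+-swapʳ (p + d + h) q (t′ * h + t * h)) (cong (_+ q) ρ-shift)))

      γ-end : γ ℓ ≡ right + v
      γ-end = trans (cong γ ℓ≡) (trans (spread-after u w (t * w) (t′ * w) (m≤m+n (u + w) v))
        (trans (+-swapʳ (u + w) v (t * w + t′ * w)) (cong (_+ v) γ-shift)))

      0<k : 0 < k
      0<k = ≤-<-trans z≤n (Fin.toℕ<n r₁)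

      0<ℓ : 0 < ℓ
      0<ℓ = ≤-<-trans z≤n (Fin.toℕ<n c₁)

      ρ-mono : ∀ {i j} → i < j → ρ i < ρ j
      ρ-mono = spread-mono (p + d) h (t′ * h) (t * h)

      γ-mono : ∀ {i j} → i < j → γ i < γ j
      γ-mono = spread-mono u w (t * w) (t′ * w)

      ρ< : ∀ (i : Fin k) → ρ (toℕ i) < bottom + q
      ρ< i = subst (ρ (toℕ i) <_) ρ-end (ρ-mono (Fin.toℕ<n i))

      γ< : ∀ (j : Fin ℓ) → γ (toℕ j) < right + v
      γ< j = subst (γ (toℕ j) <_) γ-end (γ-mono (Fin.toℕ<n j))

      -- Above the blocks only the hole column of block `t`, the image of column `c₂`, can fail. By
      -- `lowest`, a 1-entry of `P` there is either in row `p`, where the new 1-entry is, or higher,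
      -- in the top margin.
      imageWithin : ∀ i j a → P i j ≡ true → toℕ i < p + d → u + a ≡ toℕ j → a < w →
        One (toℕ i) (left t + a) ⊎ (toℕ i ≡ p × left t + a ≡ left t + g)
      imageWithin i j a pij i< u+a≡j a<w with a ≟ g
      ... | no a≢g   = inj₁ (inj₂ (inj₁ (i< , a≢g ∘ hole-block {t} a<w)))
      ... | yes refl with m≤n⇒m<n∨m≡n (lowest i (subst (λ b → P i b ≡ true)
                            (Fin.toℕ-injective (trans (sym u+a≡j) (sym c₂≡))) pij) i<)
      ...   | inj₁ i<p = inj₁ (inj₁ (inj₁ (inj₁ i<p)))
      ...   | inj₂ i≡p = inj₂ (i≡p , refl)

      image : ∀ i j → P i j ≡ true →
        One (ρ (toℕ i)) (γ (toℕ j)) ⊎ (ρ (toℕ i) ≡ p × γ (toℕ j) ≡ left t + g)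
      -- The cases are, in order: left, right and bottom margin, band or top margin, and block `t`.
      image i j pij with toℕ j <? u | toℕ j <? u + w | toℕ i <? p + d | toℕ i <? p + d + h
      ... | yes j<u | _ | _ | _ = inj₁ (inj₁ (inj₂ (inj₁
        (subst (_< u) (sym (spread-before u w _ _ j<u)) j<u))))
      ... | _ | no j≮ | _ | _ = inj₁ (inj₁ (inj₂ (inj₂
        (subst (_≤ γ (toℕ j)) γ-shift (spread-after-≥ u w _ _ (≮⇒≥ j≮))))))
      ... | _ | _ | _ | no i≮ = inj₁ (inj₁ (inj₁ (inj₂
        (subst (_≤ ρ (toℕ i)) ρ-shift (spread-after-≥ (p + d) h _ _ (≮⇒≥ i≮))))))
      ... | no j≮ | yes j< | yes i< | _
        with a , u+a≡j ← m≤n⇒∃[o]m+o≡n (≮⇒≥ j≮)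
        with a<w ← +-cancelˡ-< u a w (subst (_< u + w) (sym u+a≡j) j<)
        = subst₂ (λ x y → One x y ⊎ (x ≡ p × y ≡ left t + g))
            (sym (spread-before (p + d) h _ _ i<))
            (trans (sym (spread-within u w _ _ a<w)) (cong γ u+a≡j))
            (imageWithin i j a pij i< u+a≡j a<w)
      ... | no j≮ | yes j< | no i≮ | yes i<
        with a , u+a≡j ← m≤n⇒∃[o]m+o≡n (≮⇒≥ j≮)
           | b , p+d+b≡i ← m≤n⇒∃[o]m+o≡n (≮⇒≥ i≮)
        with a<w ← +-cancelˡ-< u a w (subst (_< u + w) (sym u+a≡j) j<)
           | b<h ← +-cancelˡ-< (p + d) b h (subst (_< p + d + h) (sym p+d+b≡i) i<)
        = inj₁ (subst₂ One
            (trans (sym (spread-within (p + d) h _ _ b<h)) (cong ρ p+d+b≡i))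
            (trans (sym (spread-within u w _ _ a<w)) (cong γ u+a≡j))
            (inj₂ (inj₂ (t , t<B
              , (m≤m+n (top t) b , +-monoʳ-< (top t) b<h)
              , (m≤m+n (left t) a , +-monoʳ-< (left t) a<w)))))

    criticalStaircase : 0 < e → 0 < g′ →
      P r₁ c₂ ≡ true → P r₂ c₁ ≡ true → P r₃ c₃ ≡ true →
      (∀ i → P i c₂ ≡ true → toℕ i < p + d → toℕ i ≤ p) →
      ∃[ M′ ] (Critical (Av P) {bottom + q} {right + v} M′ × B ≤ maxRowComplexity M′)
    criticalStaircase 0<e 0<g′ p₁₂ p₂₁ p₃₃ lowest =
      let M′ , critical , B≤ = criticalRow P M (avoids 0<e 0<g′ p₁₂ p₂₁ p₃₃) row hole separator
            (λ t → contains (Fin.toℕ<n t) lowest row (hole t) row≡ (hole≡ t))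
            ones
            (λ {t} {t′} t<t′ → subst₂ _<_ (sym (hole≡ t)) (sym (separator≡ t′))
              (<-≤-trans (+-monoʳ-< (left (toℕ t)) g<w) (left-< t<t′)))
            (λ t → subst₂ _<_ (sym (separator≡ t)) (sym (hole≡ t)) (m<m+n (left (toℕ t)) 0<g))
      in M′ , critical , ≤-trans B≤ (complexity≤maxRowComplexity M′ row)
      where
      p<p+d : p < p + d
      p<p+d = m<m+n p 0<d

      p<bottom : p < bottom + q
      p<bottom = <-≤-trans p<p+d (≤-trans (m≤m+n (p + d) (B * h)) (m≤m+n bottom q))

      row : Fin (bottom + q)
      row = fromℕ< p<bottom

      row≡ : toℕ row ≡ p
      row≡ = Fin.toℕ-fromℕ< p<bottom

      column< : ∀ (t : Fin B) {a} → a < w → left (toℕ t) + a < right + v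
      column< t a<w = <-≤-trans (+-monoʳ-< (left (toℕ t)) a<w)
        (≤-trans (left-< (Fin.toℕ<n t)) (m≤m+n right v))

      -- The separator is the first column of its block: its offset 0 differs from the offset `g` of
      -- the hole because `0 < g`.
      hole separator : Fin B → Fin (right + v)
      hole t      = fromℕ< (column< t g<w)
      separator t = fromℕ< (column< t {0} z<s)

      hole≡ : ∀ t → toℕ (hole t) ≡ left (toℕ t) + g
      hole≡ t = Fin.toℕ-fromℕ< (column< t g<w)

      separator≡ : ∀ t → toℕ (separator t) ≡ left (toℕ t)
      separator≡ t = trans (Fin.toℕ-fromℕ< (column< t z<s)) (+-identityʳ _)

      ones : ∀ t → M row (separator t) ≡ true
      ones t = dec-true (one? _ _) (inj₂ (inj₁
        ( subst (_< p + d) (sym row≡) p<p+d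
        , λ hole → <⇒≢ 0<g (hole-block {toℕ t} z<s
            (subst Hole (Fin.toℕ-fromℕ< (column< t z<s)) hole)))))

-- The occurrence of `Q₁` and the choice of parameters.

Q₁-occurrence : ∀ {k ℓ} {P : Matrix k ℓ} → Q₁ ≼ P →
  ∃[ r₁ ] ∃[ r₂ ] ∃[ r₃ ] ∃[ c₁ ] ∃[ c₂ ] ∃[ c₃ ]
    ( r₁ Fin.< r₂ × r₂ Fin.< r₃ × c₁ Fin.< c₂ × c₂ Fin.< c₃
    × P r₁ c₂ ≡ true × P r₂ c₁ ≡ true × P r₃ c₃ ≡ true
    × (∀ i → P i c₂ ≡ true → i Fin.< r₂ → i Fin.≤ r₁))
Q₁-occurrence {P = P} (r , c , f)
  with x₀ , y₀ , x₀∈ , y₀∈ , p₁₂ ← f zero (suc zero) refl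
     | x₁ , y₁ , x₁∈ , y₁∈ , p₂₁ ← f (suc zero) zero refl
     | x₂ , y₂ , x₂∈ , y₂∈ , p₃₃ ← f (suc (suc zero)) (suc (suc zero)) refl
  -- Moving the entry of column `y₀` down to the lowest one above row `x₁` keeps the shape of `Q₁`;
  -- `contains` relies on there being no 1-entry in between.
  with r₁ , (r₁<x₁ , p₁) , lowest ← greatest (λ i → (i Fin.<? x₁) ×-dec (P i y₀ Bool.≟ true))
         (x₀ , <-≤-trans (proj₂ x₀∈) (proj₁ x₁∈) , p₁₂)
  = r₁ , x₁ , x₂ , y₁ , y₀ , y₂
  , r₁<x₁ , <-≤-trans (proj₂ x₁∈) (proj₁ x₂∈)
  , <-≤-trans (proj₂ y₁∈) (proj₁ y₀∈) , <-≤-trans (proj₂ y₀∈) (proj₁ y₂∈)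
  , p₁ , p₂₁ , p₃₃ , λ i pi i<x₁ → lowest i (i<x₁ , pi)

theorem3p4 : ∀ {k ℓ : ℕ} (P : Matrix k ℓ) → Q₁ ≼ P → RowUnbounded (Av P)
theorem3p4 {k} {ℓ} P Q₁≼P N
  with r₁ , r₂ , r₃ , c₁ , c₂ , c₃ , r₁<r₂ , r₂<r₃ , c₁<c₂ , c₂<c₃ , p₁₂ , p₂₁ , p₃₃ , lowest
         ← Q₁-occurrence Q₁≼P
  = _ , _ , criticalStaircase P
      {r₁} {r₂} {r₃} {c₁} {c₂} {c₃}
      refl (split r₁<r₂) (trans (split r₂<r₃) (cong (_+ e) (split r₁<r₂)))
      refl (split c₁<c₂) (trans (split c₂<c₃) (cong (_+ g′) (split c₁<c₂)))
      (size r₁<r₂ r₂<r₃) (trans (size c₁<c₂ c₂<c₃) (cong (_+ v) (regroup (toℕ c₁) g g′)))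
      (m<n⇒0<n∸m r₂<r₃) (m<n⇒0<n∸m c₂<c₃) p₁₂ p₂₁ p₃₃
      (λ i pi i< → lowest i pi (subst (toℕ i <_) (sym (split r₁<r₂)) i<))
  where
  d = toℕ r₂ ∸ toℕ r₁
  e = toℕ r₃ ∸ toℕ r₂
  g = toℕ c₂ ∸ toℕ c₁
  g′ = toℕ c₃ ∸ toℕ c₂
  q = k ∸ suc (toℕ r₃)
  v = ℓ ∸ suc (toℕ c₃)

  -- `suc N` blocks give at least `suc N` zero runs in one row, which is the strict bound asked for.
  -- `q` and `v` count the lines of `P` after `r₃` and `c₃`.
  open Staircase (toℕ r₁) d e q (toℕ c₁) g g′ v (suc N) (m<n⇒0<n∸m r₁<r₂) (m<n⇒0<n∸m c₁<c₂)

  split : ∀ {n} {a b : Fin n} → a Fin.< b → toℕ b ≡ toℕ a + (toℕ b ∸ toℕ a)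
  split a<b = sym (m+[n∸m]≡n (<⇒≤ a<b))

  regroup : ∀ a b c → a + b + suc c ≡ a + suc (b + c)
  regroup = solve-∀

  size : ∀ {n} {a b c : Fin n} → a Fin.< b → b Fin.< c →
    n ≡ toℕ a + (toℕ b ∸ toℕ a) + suc (toℕ c ∸ toℕ b) + (n ∸ suc (toℕ c))
  size {n} {a} {b} {c} a<b b<c = trans (sym (m+[n∸m]≡n (Fin.toℕ<n c)))
    (cong (_+ (n ∸ suc (toℕ c))) (trans (cong suc (trans (split b<c) (cong (_+ (toℕ c ∸ toℕ b)) (split a<b))))
      (sym (+-suc (toℕ a + (toℕ b ∸ toℕ a)) (toℕ c ∸ toℕ b)))))
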